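{- Let $p\equiv 1\pmod 4$ be a prime and $L_p=(p-1)(p-5)/96$. Let $X=\{(a,b)\in V\times V : a<b<\overline{a}<\overline{b}\}$, $Y=\{(a,b)\in V\times V : a<\overline{a}<b<\overline{b}\}$, $Z=\{(a,b)\in V\times V : a<b<\overline{b}<\overline{a}\}$. Then $|Y|=L_p$ and $|X|+|Z|=2L_p$.
   Context: For an integer $x$, $\{x\}_p$ denotes the least nonnegative residue of $x$ modulo $p$, and $\widetilde{x}=p-\{x\}_p$ if $\{x\}_p>p/2$, while $\widetilde{x}=\{x\}_p$ if $\{x\}_p<p/2$. Let $t=\prod_{x=1}^{(p-1)/2}x$. Let $V=\{x : 1\le x\le (p-1)/2,\ x<\widetilde{tx}\}$, and for $a\in V$ put $\overline{a}=\widetilde{ta}$. -}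

module Defs where

open import Data.Nat using (ℕ; zero; suc; _+_; _*_; _∸_; _<_; _<ᵇ_; _!)
open import Data.Nat.DivMod using (_%_; _/_)

open import Data.Bool using (Bool; if_then_else_; _∧_)
open import Data.List using (List; filterᵇ; map; concatMap; length; upTo)
open import Data.Product using (_×_; _,_)

half : ℕ → ℕ
half p = (p ∸ 1) / 2

-- {x}_p for p ≥ 1 (p = suc q)
-- tilde p x : if {x}_p > p/2 then p - {x}_p else {x}_p  (p odd, so {x}_p ≠ p/2)
tilde : ℕ → ℕ → ℕ
tilde zero x = x
tilde (suc q) x =
  let r = x % suc q in
  if suc q <ᵇ 2 * r then suc q ∸ r else r

tval : ℕ → ℕ
tval p = (half p) !

bar : ℕ → ℕ → ℕ
bar p a = tilde p (tval p * a)

range : ℕ → List ℕ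
range p = map suc (upTo (half p))

V : ℕ → List ℕ
V p = filterᵇ (λ x → x <ᵇ bar p x) (range p)

pairsV : ℕ → List (ℕ × ℕ)
pairsV p = concatMap (λ a → map (λ b → (a , b)) (V p)) (V p)

chain4 : ℕ → ℕ → ℕ → ℕ → Bool
chain4 a b c d = (a <ᵇ b) ∧ (b <ᵇ c) ∧ (c <ᵇ d)

X : ℕ → List (ℕ × ℕ)
X p = filterᵇ (λ { (a , b) → chain4 a b (bar p a) (bar p b) }) (pairsV p)

Y : ℕ → List (ℕ × ℕ)
Y p = filterᵇ (λ { (a , b) → chain4 a (bar p a) b (bar p b) }) (pairsV p)

Z : ℕ → List (ℕ × ℕ)
Z p = filterᵇ (λ { (a , b) → chain4 a b (bar p b) (bar p a) }) (pairsV p)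

{-# OPTIONS --safe #-}
module Submission where

-- Write p = 4n + 1 and h = 2n.  By Wilson's theorem t² ≡ −1 (mod p), so x ↦ x̄ is a
-- fixed-point-free involution of {1, …, h}, characterised by p ∣ x² + x̄²; read it as n chords
-- on h points, with V the set of left endpoints.  Since (ā − a)² + (ā + a)² = 2 (a² + ā²), the
-- partner of ā − a is ā + a or p − (ā + a), both larger than ā − a.  Thus a ↦ ā − a maps V to
-- itself; it is injective because p is odd, and so Σ ā = 2 Σ a over V.  Together with
-- Σ a + Σ ā = h (h + 1) / 2 this determines Σ a.  Counting the endpoints left of each a gives
-- Σ a = n + 2 |Y| + |X| + |Z|, and those strictly between a and ā give
-- Σ (ā − a) = n + 2 (|X| + |Z|).

open import Defs
open import Algebra.Structures using (IsCommutativeMonoid)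
open import Data.Bool using (Bool; true; false; if_then_else_; T; _∧_; not)
open import Data.Bool.Properties using (T?)
open import Data.Empty using (⊥-elim)
open import Data.List using (List; []; _∷_; _++_; _∷ʳ_; length; map; filterᵇ; applyUpTo; upTo; concatMap; foldr)
open import Data.List.Membership.Propositional using (_∈_)
open import Data.List.Membership.Propositional.Properties using (∈-∃++; ∈-map⁺; ∈-map⁻; ∈-filter⁺; ∈-filter⁻; ∈-upTo⁺; ∈-upTo⁻)
open import Data.List.Properties using (length-map; length-upTo; map-∘; map-++; map-upTo; map-cong-local; upTo-∷ʳ)
open import Data.List.Relation.Binary.Permutation.Propositional using (_↭_; prep; ↭-refl; ↭-sym; ↭-trans; ↭⇒↭ₛ)
open import Data.List.Relation.Binary.Permutation.Propositional.Properties using (map⁺; shift; ∈-resp-↭; ↭-length)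
import Data.List.Relation.Binary.Permutation.Setoid.Properties as PermₛProperties
open import Data.List.Relation.Unary.All as All using (All; []; _∷_)
open import Data.List.Relation.Unary.AllPairs using ([]; _∷_)
open import Data.List.Relation.Unary.Any using (here; there)
open import Data.List.Relation.Unary.Unique.Propositional using (Unique)
import Data.List.Relation.Unary.Unique.Propositional.Properties as Uniqueₚ
open import Data.Nat using (ℕ; zero; suc; _+_; _*_; _∸_; _%_; _/_; _!; _≤_; _<_; _<ᵇ_; z≤n; s≤s; NonZero)
open import Data.Nat.Divisibility
open import Data.Nat.DivMod using (m≡m%n+[m/n]*n; m%n<n; m*n/n≡m)
open import Data.Nat.ListAction using (sum)
open import Data.Nat.ListAction.Properties using (sum-++)
open import Data.Nat.Properties
open import Data.Nat.Tactic.RingSolver using (solve-∀)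
open import Data.Nat.Coprimality using (prime⇒coprime; coprime⇒GCD≡1)
open import Data.Nat.GCD using (module GCD; module Bézout)
open import Data.Nat.Primality using (Prime; euclidsLemma; ¬prime[0]; ¬prime[1]; prime⇒nonZero)
open import Data.Sum using (_⊎_; inj₁; inj₂; [_,_]′)
open import Data.Product using (_×_; _,_; proj₁; proj₂)
open import Function using (_∘_; id)
open import Relation.Binary.Definitions using (tri<; tri≈; tri>)
open import Relation.Binary.PropositionalEquality
open import Relation.Nullary using (yes; no)

-- Lists without repetition and injective self-maps

private
  variable
    A B : Set

InjectiveOn : List A → (A → B) → Set
InjectiveOn xs f = ∀ {x y} → x ∈ xs → y ∈ xs → f x ≡ f y → x ≡ y

Unique-map : ∀ {f : A → B} {xs} → InjectiveOn xs f → Unique xs → Unique (map f xs)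
Unique-map {xs = []} inj [] = []
Unique-map {f = f} {xs = x ∷ xs} inj (x∉xs ∷ xs!) =
  All.tabulate fresh ∷ Unique-map (λ y∈ z∈ → inj (there y∈) (there z∈)) xs!
  where
  fresh : ∀ {z} → z ∈ map f xs → f x ≢ z
  fresh z∈ fx≡z with y , y∈ , refl ← ∈-map⁻ f z∈ =
    All.lookup x∉xs y∈ (inj (here refl) (there y∈) fx≡z)

-- Pigeonhole by deletion: each entry of `xs` is struck out of `ys`, and the length bound leaves
-- nothing of `ys` once `xs` is exhausted.
Unique-⊆⇒↭ : ∀ {xs ys : List A} → Unique xs → (∀ {x} → x ∈ xs → x ∈ ys) →
             length ys ≤ length xs → xs ↭ ys
Unique-⊆⇒↭ {xs = []} {[]} [] sub len = ↭-refl
Unique-⊆⇒↭ {xs = x ∷ xs} (x∉xs ∷ xs!) sub len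
  with ls , rs , refl ← ∈-∃++ (sub (here refl)) =
  ↭-trans (prep x (Unique-⊆⇒↭ xs! sub′ len′)) (↭-sym (shift x ls rs))
  where
  sub′ : ∀ {y} → y ∈ xs → y ∈ ls ++ rs
  sub′ y∈ with ∈-resp-↭ (shift x ls rs) (sub (there y∈))
  ... | here refl = ⊥-elim (All.lookup x∉xs y∈ refl)
  ... | there y∈′ = y∈′
  len′ : length (ls ++ rs) ≤ length xs
  len′ = ≤-pred (≤-trans (≤-reflexive (sym (↭-length (shift x ls rs)))) len)

map-injection-↭ : ∀ {f : A → A} {xs} → Unique xs → (∀ {x} → x ∈ xs → f x ∈ xs) →
                  InjectiveOn xs f → map f xs ↭ xs
map-injection-↭ {f = f} {xs} xs! closed inj =
  Unique-⊆⇒↭ (Unique-map inj xs!) sub (≤-reflexive (sym (length-map f xs)))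
  where
  sub : ∀ {y} → y ∈ map f xs → y ∈ xs
  sub y∈ with x , x∈ , refl ← ∈-map⁻ f y∈ = closed x∈

-- Folds over a commutative monoid, for both sums and products

module Fold {_∙_ : ℕ → ℕ → ℕ} {ε : ℕ} (isCM : IsCommutativeMonoid _≡_ _∙_ ε) where

  open IsCommutativeMonoid isCM using (assoc; comm; identityˡ; identityʳ)

  fold : (A → ℕ) → List A → ℕ
  fold f xs = foldr _∙_ ε (map f xs)

  fold-↭ : ∀ (f : ℕ → ℕ) {xs ys} → xs ↭ ys → fold f xs ≡ fold f ys
  fold-↭ f xs↭ys = PermₛProperties.foldr-commMonoid (setoid ℕ) isCM (↭⇒↭ₛ (map⁺ f xs↭ys))

  fold-∙ : ∀ (f g : A → ℕ) xs → fold (λ x → f x ∙ g x) xs ≡ fold f xs ∙ fold g xs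
  fold-∙ f g [] = sym (identityˡ ε)
  fold-∙ f g (x ∷ xs) = begin
    (f x ∙ g x) ∙ fold (λ x → f x ∙ g x) xs ≡⟨ cong ((f x ∙ g x) ∙_) (fold-∙ f g xs) ⟩
    (f x ∙ g x) ∙ (fold f xs ∙ fold g xs)   ≡⟨ assoc (f x) (g x) _ ⟩
    f x ∙ (g x ∙ (fold f xs ∙ fold g xs))   ≡⟨ cong (f x ∙_) (sym (assoc (g x) _ _)) ⟩
    f x ∙ ((g x ∙ fold f xs) ∙ fold g xs)   ≡⟨ cong (λ z → f x ∙ (z ∙ fold g xs)) (comm (g x) _) ⟩
    f x ∙ ((fold f xs ∙ g x) ∙ fold g xs)   ≡⟨ cong (f x ∙_) (assoc _ (g x) _) ⟩
    f x ∙ (fold f xs ∙ (g x ∙ fold g xs))   ≡⟨ sym (assoc (f x) _ _) ⟩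
    (f x ∙ fold f xs) ∙ (g x ∙ fold g xs)   ∎
    where open ≡-Reasoning

  fold-cong : ∀ {f g : A → ℕ} xs → (∀ {x} → x ∈ xs → f x ≡ g x) → fold f xs ≡ fold g xs
  fold-cong xs eq = cong (foldr _∙_ ε) (map-cong-local (All.tabulate eq))

  fold-upTo : ∀ (f : ℕ → ℕ) n → fold f (upTo (suc n)) ≡ fold f (upTo n) ∙ f n
  fold-upTo f n = trans (cong (fold f) (sym (upTo-∷ʳ n))) (snoc (upTo n))
    where
    snoc : ∀ xs → fold f (xs ∷ʳ n) ≡ fold f xs ∙ f n
    snoc [] = comm (f n) ε
    snoc (x ∷ xs) = trans (cong (f x ∙_) (snoc xs)) (sym (assoc (f x) _ _))

  fold-filterᵇ : ∀ (q : A → Bool) (f : A → ℕ) xs →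
                 fold f (filterᵇ q xs) ≡ fold (λ x → if q x then f x else ε) xs
  fold-filterᵇ q f [] = refl
  fold-filterᵇ q f (x ∷ xs) with q x
  ... | true  = cong (f x ∙_) (fold-filterᵇ q f xs)
  ... | false = trans (fold-filterᵇ q f xs) (sym (identityˡ _))

  -- Each `f x` is booked as `small` or `large` according to whether `x` is the lesser or the
  -- greater member of its orbit. Reindexing the `large` part along `σ` brings both contributions to
  -- the lesser member. This serves the pairing of inverses in Wilson's theorem and every sum over
  -- chords.
  fold-involution : ∀ {σ : ℕ → ℕ} {xs} → Unique xs → (∀ {x} → x ∈ xs → σ x ∈ xs) →
    (∀ {x} → x ∈ xs → σ (σ x) ≡ x) → (∀ {x} → x ∈ xs → σ x ≢ x) → (f : ℕ → ℕ) →
    fold f xs ≡ fold (λ x → f x ∙ f (σ x)) (filterᵇ (λ x → x <ᵇ σ x) xs)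
  fold-involution {σ} {xs} xs! closed invol free f = begin
    fold f xs
      ≡⟨ fold-cong xs (λ {x} x∈ → split x (free x∈)) ⟩
    fold (λ x → small x ∙ large x) xs
      ≡⟨ fold-∙ small large xs ⟩
    fold small xs ∙ fold large xs
      ≡⟨ cong (fold small xs ∙_) (sym (fold-↭ large (map-injection-↭ xs! closed inj))) ⟩
    fold small xs ∙ fold large (map σ xs)
      ≡⟨ cong (λ l → fold small xs ∙ foldr _∙_ ε l) (sym (map-∘ {g = large} {f = σ} xs)) ⟩
    fold small xs ∙ fold (large ∘ σ) xs
      ≡⟨ sym (fold-∙ small (large ∘ σ) xs) ⟩
    fold (λ x → small x ∙ large (σ x)) xs
      ≡⟨ fold-cong xs (λ {x} x∈ → merge x (invol x∈)) ⟩
    fold (λ x → if x <ᵇ σ x then f x ∙ f (σ x) else ε) xs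
      ≡⟨ sym (fold-filterᵇ (λ x → x <ᵇ σ x) (λ x → f x ∙ f (σ x)) xs) ⟩
    fold (λ x → f x ∙ f (σ x)) (filterᵇ (λ x → x <ᵇ σ x) xs) ∎
    where
    open ≡-Reasoning
    small large : ℕ → ℕ
    small x = if x <ᵇ σ x then f x else ε
    large x = if σ x <ᵇ x then f x else ε
    inj : InjectiveOn xs σ
    inj x∈ y∈ eq = trans (sym (invol x∈)) (trans (cong σ eq) (invol y∈))
    split : ∀ x → σ x ≢ x → f x ≡ small x ∙ large x
    split x σx≢x with x <ᵇ σ x in e₁ | σ x <ᵇ x in e₂
    ... | true  | false = sym (identityʳ _)
    ... | false | true  = sym (identityˡ _)
    ... | true  | true  = ⊥-elim (<-asym (<ᵇ⇒< x (σ x) (subst T (sym e₁) _)) (<ᵇ⇒< (σ x) x (subst T (sym e₂) _)))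
    ... | false | false = ⊥-elim (σx≢x (≤-antisym (≮⇒≥ (λ lt → subst T e₁ (<⇒<ᵇ lt))) (≮⇒≥ (λ lt → subst T e₂ (<⇒<ᵇ lt)))))
    merge : ∀ x → σ (σ x) ≡ x → small x ∙ large (σ x) ≡ (if x <ᵇ σ x then f x ∙ f (σ x) else ε)
    merge x eq rewrite eq with x <ᵇ σ x
    ... | true  = refl
    ... | false = identityˡ ε

module Sum = Fold +-0-isCommutativeMonoid
module Prod = Fold *-1-isCommutativeMonoid

-- Divisibility, inverses modulo p and Wilson's theorem

∣m+n∣n⇒∣m : ∀ {d m n} → d ∣ m + n → d ∣ n → d ∣ m
∣m+n∣n⇒∣m {d} {m} {n} d∣m+n = ∣m+n∣m⇒∣n (subst (d ∣_) (+-comm m n) d∣m+n)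

∣∧<⇒≡0 : ∀ {d n} → d ∣ n → n < d → n ≡ 0
∣∧<⇒≡0 {n = zero}  _   _   = refl
∣∧<⇒≡0 {n = suc _} d∣n n<d = ⊥-elim (<⇒≱ n<d (∣⇒≤ d∣n))

∣∧<2*⇒≡ : ∀ {d n} → d ∣ n → 0 < n → n < d + d → n ≡ d
∣∧<2*⇒≡ {d} (divides zero          refl) 0<n n<2d = ⊥-elim (<-irrefl refl 0<n)
∣∧<2*⇒≡ {d} (divides (suc zero)    refl) 0<n n<2d = +-identityʳ d
∣∧<2*⇒≡ {d} (divides (suc (suc q)) refl) 0<n n<2d =
  ⊥-elim (<⇒≱ n<2d (+-monoʳ-≤ d (m≤m+n d (q * d))))

-- Residues are compared through divisibility of sums, so that no subtraction
-- occurs: x y ≡ 1 modulo suc r reads suc r ∣ x * y + r.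
module Inverse {r : ℕ} (pr : Prime (suc r)) where

  private
    p : ℕ
    p = suc r

    reduce : ∀ x u → p ∣ x * u + r → p ∣ x * (u % p) + r
    reduce x u d = ∣m+n∣n⇒∣m (subst (p ∣_) eq d) (n∣m*n (x * (u / p)))
      where
      ring : ∀ x v q p r → x * (v + q * p) + r ≡ x * v + r + x * q * p
      ring = solve-∀
      eq : x * u + r ≡ x * (u % p) + r + x * (u / p) * p
      eq = trans (cong (λ z → x * z + r) (m≡m%n+[m/n]*n u p)) (ring x (u % p) (u / p) p r)

  abstract
    inverse : ℕ → ℕ
    inverse x with Bézout.lemma x p
    ... | Bézout.result _ _ (Bézout.+- u _ _) = u % p
    -- Here 1 + u x is a multiple of p, so the inverse is -u; the factor `r` plays the part of -1.
    ... | Bézout.result _ _ (Bézout.-+ u _ _) = (u * r) % p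

    inverse< : ∀ x → inverse x < p
    inverse< x with Bézout.lemma x p
    ... | Bézout.result _ _ (Bézout.+- u _ _) = m%n<n u p
    ... | Bézout.result _ _ (Bézout.-+ u _ _) = m%n<n (u * r) p

    inverse-spec : ∀ {x} → 0 < x → x < p → p ∣ x * inverse x + r
    inverse-spec {x@(suc _)} 0<x x<p with Bézout.lemma x p
    ... | Bézout.result d g b
        with refl ← GCD.unique g (GCD.sym (coprime⇒GCD≡1 (prime⇒coprime pr x<p)))
        with b
    ... | Bézout.+- u v eq = reduce x u (divides (suc v) (trans (cong (_+ r) (trans (*-comm x u) (sym eq))) (ring v r)))
      where
      ring : ∀ v r → 1 + v * suc r + r ≡ suc v * suc r
      ring = solve-∀
    ... | Bézout.-+ u v eq = reduce x (u * r) (divides (r * v) (trans (ring x u r) (trans (cong (r *_) eq) (sym (*-assoc r v p)))))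
      where
      ring : ∀ x u r → x * (u * r) + r ≡ r * (1 + u * x)
      ring = solve-∀

  private
    -- Writing z = y + d, the difference of the two hypotheses is p ∣ x d. Since p does not divide
    -- x, it divides d < p, whence d = 0.
    inverse-unique-≤ : ∀ {x y z} → 0 < x → x < p → z < p →
      p ∣ x * y + r → p ∣ x * z + r → y ≤ z → y ≡ z
    inverse-unique-≤ {x} {y} 0<x x<p z<p dy dz y≤z with d , refl ← m≤n⇒∃[o]m+o≡n y≤z
      with euclidsLemma x d pr (∣m+n∣m⇒∣n (subst (p ∣_) (ring x y d r) dz) dy)
      where
      ring : ∀ x y d r → x * (y + d) + r ≡ x * y + r + x * d
      ring = solve-∀
    ... | inj₁ p∣x = ⊥-elim (<⇒≢ 0<x (sym (∣∧<⇒≡0 p∣x x<p)))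
    ... | inj₂ p∣d with refl ← ∣∧<⇒≡0 p∣d (≤-<-trans (m≤n+m d y) z<p) = sym (+-identityʳ y)

  inverse-unique : ∀ {x y z} → 0 < x → x < p → y < p → z < p →
    p ∣ x * y + r → p ∣ x * z + r → y ≡ z
  inverse-unique {y = y} {z} 0<x x<p y<p z<p dy dz with ≤-total y z
  ... | inj₁ y≤z = inverse-unique-≤ 0<x x<p z<p dy dz y≤z
  ... | inj₂ z≤y = sym (inverse-unique-≤ 0<x x<p y<p dz dy z≤y)

  prod≡1 : ∀ {A : Set} (f : A → ℕ) xs → (∀ {x} → x ∈ xs → p ∣ f x + r) → p ∣ Prod.fold f xs + r
  prod≡1 f [] h = ∣-refl
  prod≡1 f (x ∷ xs) h =
    -- Since r ≡ -1, the induction hypothesis and the head say b ≡ 1 and a ≡ 1; the identity `ring`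
    -- derives a b ≡ 1 without subtraction.
    ∣m+n∣n⇒∣m
      (subst (p ∣_) (ring (f x) (Prod.fold f xs) r)
        (∣m∣n⇒∣m+n (∣n⇒∣m*n (f x) (prod≡1 f xs (h ∘ there))) (n∣m*n r)))
      (∣n⇒∣m*n r (h (here refl)))
    where
    ring : ∀ a b r → a * (b + r) + r * suc r ≡ a * b + r + r * (a + r)
    ring = solve-∀

product-2⋯ : ∀ m → Prod.fold (2 +_) (upTo m) ≡ suc m !
product-2⋯ zero = refl
product-2⋯ (suc m) = trans (Prod.fold-upTo (2 +_) m) (trans (cong (_* (2 + m)) (product-2⋯ m)) (*-comm (suc m !) (2 + m)))

-- The factors 2, …, p − 2 of (p − 1)! cancel in pairs of inverses.
wilson : ∀ {p} → Prime p → p ∣ (p ∸ 1) ! + 1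
wilson {0} pr = ⊥-elim (¬prime[0] pr)
wilson {1} pr = ⊥-elim (¬prime[1] pr)
wilson {2} pr = ∣-refl
wilson {suc (suc (suc m))} pr =
  -- The pairing gives p ∣ (p - 2)! + r. Multiplied by r = p - 1 and increased by p, this is (p -
  -- 1)! + 1 plus the multiple r p.
  ∣m+n∣m⇒∣n
    (subst (p ∣_) (trans (cong (λ z → r * (z + r) + p) whole) (ring (suc m !) m))
      (∣m∣n⇒∣m+n (∣n⇒∣m*n r (prod≡1 (λ x → x * inverse x) (filterᵇ (λ x → x <ᵇ inverse x) L) pairs)) ∣-refl))
    (n∣m*n r)
  where
  r p : ℕ
  r = suc (suc m)
  p = suc r
  open Inverse pr
  L : List ℕ
  L = map (2 +_) (upTo m)
  ring : ∀ f m → (2 + m) * (f + (2 + m)) + (3 + m) ≡ (2 + m) * (3 + m) + ((2 + m) * f + 1)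
  ring = solve-∀
  L! : Unique L
  L! = Uniqueₚ.map⁺ (+-cancelˡ-≡ 2 _ _) (Uniqueₚ.upTo⁺ m)
  L⁻ : ∀ {x} → x ∈ L → 2 ≤ x × x < r
  L⁻ x∈ with i , i∈ , refl ← ∈-map⁻ (2 +_) x∈ = s≤s (s≤s z≤n) , s≤s (s≤s (∈-upTo⁻ i∈))
  L⁺ : ∀ {x} → 2 ≤ x → x < r → x ∈ L
  L⁺ (s≤s (s≤s z≤n)) (s≤s (s≤s i<m)) = ∈-map⁺ (2 +_) (∈-upTo⁺ i<m)
  spec : ∀ {x} → x ∈ L → p ∣ x * inverse x + r
  spec x∈ with 2≤x , x<r ← L⁻ x∈ = inverse-spec (<-trans (s≤s z≤n) 2≤x) (m<n⇒m<1+n x<r)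
  pairs : ∀ {x} → x ∈ filterᵇ (λ x → x <ᵇ inverse x) L → p ∣ x * inverse x + r
  pairs x∈ = spec (proj₁ (∈-filter⁻ (λ x → T? (x <ᵇ inverse x)) {xs = L} x∈))
  closed : ∀ {x} → x ∈ L → inverse x ∈ L
  closed {x} x∈ with L⁻ x∈ | spec x∈ | inverse< x
  closed {suc (suc k)} x∈ | s≤s (s≤s _) , x<r | d | y<p with inverse (suc (suc k))
  -- The values 0, 1 and p - 1 of the inverse are excluded: they would make p divide r, x - 1 and (x
  -- + 1) r respectively.
  ... | 0 = ⊥-elim (0≢1+n (sym (∣∧<⇒≡0 (subst (λ z → p ∣ z + r) (*-zeroʳ k) d) ≤-refl)))
  ... | 1 = ⊥-elim (0≢1+n (sym (∣∧<⇒≡0 {n = suc k} (∣m+n∣n⇒∣m (subst (p ∣_) (ring′ k r) d) ∣-refl) (<-trans (n<1+n _) (m<n⇒m<1+n x<r)))))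
    where
    ring′ : ∀ k r → suc (suc k) * 1 + r ≡ suc k + suc r
    ring′ = solve-∀
  ... | suc (suc y) = L⁺ (s≤s (s≤s z≤n)) (≤∧≢⇒< (≤-pred y<p) absurd)
    where
    ring′ : ∀ x r → x * r + r ≡ suc x * r
    ring′ = solve-∀
    absurd : suc (suc y) ≢ r
    absurd refl with euclidsLemma (suc (suc (suc k))) r pr (subst (p ∣_) (ring′ (suc (suc k)) r) d)
    ... | inj₁ e = 0≢1+n (sym (∣∧<⇒≡0 e (s≤s x<r)))
    ... | inj₂ e = 0≢1+n (sym (∣∧<⇒≡0 e ≤-refl))
  invol : ∀ {x} → x ∈ L → inverse (inverse x) ≡ x
  invol {x} x∈ with 2≤y , y<r ← L⁻ (closed x∈) =
    inverse-unique (<-trans (s≤s z≤n) 2≤y) (m<n⇒m<1+n y<r) (inverse< (inverse x)) (m<n⇒m<1+n (proj₂ (L⁻ x∈)))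
      (spec (closed x∈)) (subst (λ z → p ∣ z + r) (*-comm x (inverse x)) (spec x∈))
  free : ∀ {x} → x ∈ L → inverse x ≢ x
  free {x} x∈ eq with L⁻ x∈ | subst (λ z → p ∣ x * z + r) eq (spec x∈)
  free {suc (suc k)} x∈ eq | s≤s (s≤s _) , x<r | d
    -- A fixed point satisfies x² ≡ 1, so p divides x - 1 or x + 1, both of which lie strictly
    -- between 0 and p.
    with euclidsLemma (suc k) (3 + k) pr (∣m+n∣n⇒∣m (subst (p ∣_) (ring′ k r) d) ∣-refl)
    where
    ring′ : ∀ k r → (2 + k) * (2 + k) + r ≡ (1 + k) * (3 + k) + (1 + r)
    ring′ = solve-∀
  ... | inj₁ e = 0≢1+n (sym (∣∧<⇒≡0 e (<-trans (n<1+n _) (m<n⇒m<1+n x<r))))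
  ... | inj₂ e = 0≢1+n (sym (∣∧<⇒≡0 e (s≤s x<r)))
  whole : Prod.fold (λ x → x * inverse x) (filterᵇ (λ x → x <ᵇ inverse x) L) ≡ suc m !
  whole = trans (sym (Prod.fold-involution L! closed invol free (λ x → x)))
            (trans (cong (foldr _*_ 1) (sym (map-∘ {g = λ x → x} {f = 2 +_} (upTo m)))) (product-2⋯ m))

-- Consecutive products k! (m + 1)! and (k + 1)! m! with k + m + 2 = p sum to k! m! p.
wilson-split : ∀ {p} → Prime p → ∀ j m → suc (j + j + m) ≡ p → p ∣ (j + j) ! * m ! + 1
wilson-split pr zero m refl = subst (λ z → suc m ∣ z + 1) (sym (+-identityʳ (m !))) (wilson pr)
wilson-split {p} pr (suc j) m eq rewrite +-suc j j =
  -- Moving one factor across changes the sign of the product modulo p. Two are moved at a time, so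
  -- the summand 1 keeps its sign.
  ∣m+n∣m⇒∣n
    (subst (p ∣_) (swap (k ! * M₂) (suc k ! * M₁) ((2 + k) ! * m !))
      (∣m∣n⇒∣m+n (wilson-split pr j (2 + m) eq′)
        (divides (suc k ! * m !) (trans (ring₂ k m (suc k !) (m !)) (cong (suc k ! * m ! *_) eq″)))))
    (divides (k ! * M₁) (trans (ring₁ k m (k !) M₁) (cong (k ! * M₁ *_) eq″)))
  where
  k M₁ M₂ : ℕ
  k = j + j
  M₁ = suc m !
  M₂ = (2 + m) !
  eq″ : 3 + k + m ≡ p
  eq″ = eq
  eq′ : suc (k + (2 + m)) ≡ p
  eq′ = trans (cong suc (trans (+-suc k (suc m)) (cong suc (+-suc k m)))) eq
  swap : ∀ a b c → (a + 1) + (b + c) ≡ (a + b) + (c + 1)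
  swap = solve-∀
  ring₁ : ∀ k m f g → f * ((2 + m) * g) + (1 + k) * f * g ≡ f * g * (3 + k + m)
  ring₁ = solve-∀
  ring₂ : ∀ k m f g → f * ((1 + m) * g) + (2 + k) * f * g ≡ f * g * (3 + k + m)
  ring₂ = solve-∀

-- Indicator sums, interval counts and double sums

𝟙 : Bool → ℕ
𝟙 b = if b then 1 else 0

<⇒<ᵇ≡true : ∀ {m n} → m < n → (m <ᵇ n) ≡ true
<⇒<ᵇ≡true {m} {n} m<n with m <ᵇ n | <⇒<ᵇ m<n
... | true | _ = refl

≤⇒<ᵇ≡false : ∀ {m n} → n ≤ m → (m <ᵇ n) ≡ false
≤⇒<ᵇ≡false {m} {n} n≤m with m <ᵇ n in eq
... | false = refl
... | true  = ⊥-elim (<⇒≱ (<ᵇ⇒< m n (subst T (sym eq) _)) n≤m)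

≢⇒<ᵇ≡not : ∀ {m n} → m ≢ n → (n <ᵇ m) ≡ not (m <ᵇ n)
≢⇒<ᵇ≡not {m} {n} m≢n with <-cmp m n
... | tri< m<n _ _ = trans (≤⇒<ᵇ≡false (<⇒≤ m<n)) (cong not (sym (<⇒<ᵇ≡true m<n)))
... | tri≈ _ m≡n _ = ⊥-elim (m≢n m≡n)
... | tri> _ _ n<m = trans (<⇒<ᵇ≡true n<m) (cong not (sym (≤⇒<ᵇ≡false (<⇒≤ n<m))))

sum-below : ∀ {r h} → r ≤ h → Sum.fold (λ x → 𝟙 (x <ᵇ suc r)) (map suc (upTo h)) ≡ r
sum-below {r} {h} r≤h = trans (cong sum (trans (sym (map-∘ (upTo h))) (map-upTo _ h))) (go r≤h)
  where
  go : ∀ {r h} → r ≤ h → sum (applyUpTo (λ i → 𝟙 (i <ᵇ r)) h) ≡ r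
  go {zero} {zero} z≤n = refl
  go {zero} {suc h} z≤n = go {zero} {h} z≤n
  go (s≤s r≤h) = cong suc (go r≤h)

-- Adding the `l` points up to `l` to those strictly between gives the r - 1 points below `r`. The
-- count r - l - 1 is stated additively to avoid truncated subtraction.
sum-between : ∀ {l r h} → l < r → r ≤ h →
  Sum.fold (λ x → 𝟙 ((l <ᵇ x) ∧ (x <ᵇ r))) (map suc (upTo h)) + suc l ≡ r
sum-between {l} {suc r} {h} l<r r≤h = begin
  Sum.fold between L + suc l                           ≡⟨ +-suc _ l ⟩
  suc (Sum.fold between L + l)                         ≡⟨ cong (λ z → suc (Sum.fold between L + z)) (sym (sum-below (≤-trans (≤-pred l<r) (<⇒≤ r≤h)))) ⟩
  suc (Sum.fold between L + Sum.fold (below l) L)      ≡⟨ cong suc (sym (Sum.fold-∙ between (below l) L)) ⟩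
  suc (Sum.fold (λ x → between x + below l x) L)       ≡⟨ cong suc (Sum.fold-cong L (λ {x} _ → pointwise x)) ⟩
  suc (Sum.fold (below r) L)                           ≡⟨ cong suc (sum-below (<⇒≤ r≤h)) ⟩
  suc r                                                ∎
  where
  open ≡-Reasoning
  L = map suc (upTo h)
  below : ℕ → ℕ → ℕ
  below k x = 𝟙 (x <ᵇ suc k)
  between : ℕ → ℕ
  between x = 𝟙 ((l <ᵇ x) ∧ (x <ᵇ suc r))
  pointwise : ∀ x → between x + below l x ≡ below r x
  pointwise x with <-≤-connex l x
  ... | inj₁ l<x rewrite <⇒<ᵇ≡true l<x | ≤⇒<ᵇ≡false l<x = +-identityʳ _
  ... | inj₂ x≤l rewrite ≤⇒<ᵇ≡false x≤l | <⇒<ᵇ≡true (s≤s x≤l) | <⇒<ᵇ≡true (≤-<-trans x≤l l<r) = refl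

sum-1⋯ : ∀ h → 2 * Sum.fold (λ x → x) (map suc (upTo h)) ≡ h * suc h
sum-1⋯ h = trans (cong (λ l → 2 * sum l) (sym (map-∘ (upTo h)))) (go h)
  where
  ring : ∀ s h → 2 * (s + suc h) ≡ 2 * s + 2 * suc h
  ring = solve-∀
  ring′ : ∀ h → h * suc h + 2 * suc h ≡ suc h * suc (suc h)
  ring′ = solve-∀
  go : ∀ h → 2 * Sum.fold suc (upTo h) ≡ h * suc h
  go zero = refl
  go (suc h) = begin
    2 * Sum.fold suc (upTo (suc h))             ≡⟨ cong (2 *_) (Sum.fold-upTo suc h) ⟩
    2 * (Sum.fold suc (upTo h) + suc h)         ≡⟨ ring (Sum.fold suc (upTo h)) h ⟩
    2 * Sum.fold suc (upTo h) + 2 * suc h       ≡⟨ cong (_+ 2 * suc h) (go h) ⟩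
    h * suc h + 2 * suc h                       ≡⟨ ring′ h ⟩
    suc h * suc (suc h)                         ∎
    where open ≡-Reasoning

sum-const : ∀ {A : Set} c (xs : List A) → Sum.fold (λ _ → c) xs ≡ length xs * c
sum-const c [] = refl
sum-const c (x ∷ xs) = cong (c +_) (sum-const c xs)

double : {A B : Set} → (A → B → ℕ) → List A → List B → ℕ
double f xs ys = Sum.fold (λ x → Sum.fold (f x) ys) xs

double-+ : ∀ {A B : Set} (f g : A → B → ℕ) xs ys →
  double (λ x y → f x y + g x y) xs ys ≡ double f xs ys + double g xs ys
double-+ f g xs ys =
  trans (Sum.fold-cong xs (λ {x} _ → Sum.fold-∙ (f x) (g x) ys))
        (Sum.fold-∙ (λ x → Sum.fold (f x) ys) (λ x → Sum.fold (g x) ys) xs)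

double-swap : ∀ {A B : Set} (f : A → B → ℕ) xs ys → double f xs ys ≡ double (λ y x → f x y) ys xs
double-swap f [] ys = sym (trans (sum-const 0 ys) (*-zeroʳ (length ys)))
double-swap f (x ∷ xs) ys =
  trans (cong (Sum.fold (f x) ys +_) (double-swap f xs ys))
        (sym (Sum.fold-∙ (f x) (λ y → Sum.fold (λ x → f x y) xs) ys))

length-filterᵇ : ∀ {A : Set} (q : A → Bool) xs → length (filterᵇ q xs) ≡ Sum.fold (𝟙 ∘ q) xs
length-filterᵇ q xs = begin
  length (filterᵇ q xs)                  ≡⟨ sym (*-identityʳ _) ⟩
  length (filterᵇ q xs) * 1              ≡⟨ sym (sum-const 1 (filterᵇ q xs)) ⟩
  Sum.fold (λ _ → 1) (filterᵇ q xs)      ≡⟨ Sum.fold-filterᵇ q (λ _ → 1) xs ⟩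
  Sum.fold (𝟙 ∘ q) xs                    ∎
  where open ≡-Reasoning

length-filterᵇ-pairs : ∀ {A B : Set} (q : A × B → Bool) xs ys →
  length (filterᵇ q (concatMap (λ a → map (λ b → a , b) ys) xs)) ≡ double (λ a b → 𝟙 (q (a , b))) xs ys
length-filterᵇ-pairs q xs ys = trans (length-filterᵇ q (concatMap (λ a → map (λ b → a , b) ys) xs)) (go xs)
  where
  go : ∀ xs → Sum.fold (𝟙 ∘ q) (concatMap (λ a → map (λ b → a , b) ys) xs) ≡ double (λ a b → 𝟙 (q (a , b))) xs ys
  go [] = refl
  go (x ∷ xs) = begin
    sum (map (𝟙 ∘ q) (row ++ rest))
      ≡⟨ cong sum (map-++ (𝟙 ∘ q) row rest) ⟩
    sum (map (𝟙 ∘ q) row ++ map (𝟙 ∘ q) rest)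
      ≡⟨ sum-++ (map (𝟙 ∘ q) row) _ ⟩
    Sum.fold (𝟙 ∘ q) row + Sum.fold (𝟙 ∘ q) rest
      ≡⟨ cong₂ _+_ (cong sum (sym (map-∘ {g = 𝟙 ∘ q} {f = λ b → x , b} ys))) (go xs) ⟩
    double (λ a b → 𝟙 (q (a , b))) (x ∷ xs) ys ∎
    where
    open ≡-Reasoning
    row = map (λ b → x , b) ys
    rest = concatMap (λ a → map (λ b → a , b) ys) xs

-- Relative position of two chords

crossing disjoint nested : (ℕ → ℕ) → ℕ → ℕ → ℕ
crossing σ a b = 𝟙 (chain4 a b (σ a) (σ b))
disjoint σ a b = 𝟙 (chain4 a (σ a) b (σ b))
nested   σ a b = 𝟙 (chain4 a b (σ b) (σ a))

Compatible : (a a′ b b′ : ℕ) → Set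
Compatible a a′ b b′ = (a ≡ b × a′ ≡ b′) ⊎ (a ≢ b × a ≢ b′ × a′ ≢ b × a′ ≢ b′)

-- A chord lying wholly to the left of `a` has two endpoints below `a`, hence the repeated term. One
-- that straddles `a` has a single endpoint there, and it either crosses the chord of `a` or
-- encloses it.
endpoints-below : ∀ {a a′ b b′} → a < a′ → b < b′ → Compatible a a′ b b′ →
  𝟙 (b <ᵇ a) + 𝟙 (b′ <ᵇ a)
    ≡ 𝟙 (chain4 b b′ a a′) + 𝟙 (chain4 b b′ a a′) + 𝟙 (chain4 b a b′ a′) + 𝟙 (chain4 b a a′ b′)
endpoints-below {a} {a′} a<a′ b<b′ (inj₁ (refl , refl))
  rewrite ≤⇒<ᵇ≡false (≤-refl {a}) | ≤⇒<ᵇ≡false (<⇒≤ a<a′) | <⇒<ᵇ≡true a<a′ = refl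
endpoints-below {a} {a′} {b} {b′} a<a′ b<b′ (inj₂ (a≢b , a≢b′ , a′≢b , a′≢b′))
  rewrite <⇒<ᵇ≡true a<a′ | <⇒<ᵇ≡true b<b′
        | ≢⇒<ᵇ≡not a≢b | ≢⇒<ᵇ≡not a≢b′ | ≢⇒<ᵇ≡not a′≢b′
  -- After the rewriting these three comparisons decide everything; the last two clauses are
  -- combinations that violate transitivity.
  with a <ᵇ b in e₁ | a <ᵇ b′ in e₂ | a′ <ᵇ b′ in e₃
... | true  | true  | _     = refl
... | false | true  | true  = refl
... | false | true  | false = refl
... | false | false | false = refl
... | true  | false | _     = ⊥-elim (subst T (trans (sym (<⇒<ᵇ≡true (<-trans (<ᵇ⇒< a b (subst T (sym e₁) _)) b<b′))) e₂) _)
... | false | false | true  = ⊥-elim (subst T (trans (sym (<⇒<ᵇ≡true (<-trans a<a′ (<ᵇ⇒< a′ b′ (subst T (sym e₃) _))))) e₂) _)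

-- A crossing chord puts one endpoint between `a` and `a′`, its left or its right one according to
-- the side from which it enters. An enclosed chord puts both there.
endpoints-between : ∀ {a a′ b b′} → a < a′ → b < b′ → Compatible a a′ b b′ →
  𝟙 ((a <ᵇ b) ∧ (b <ᵇ a′)) + 𝟙 ((a <ᵇ b′) ∧ (b′ <ᵇ a′))
    ≡ 𝟙 (chain4 a b a′ b′) + 𝟙 (chain4 b a b′ a′) + 𝟙 (chain4 a b b′ a′) + 𝟙 (chain4 a b b′ a′)
endpoints-between {a} {a′} a<a′ b<b′ (inj₁ (refl , refl))
  rewrite ≤⇒<ᵇ≡false (≤-refl {a}) | ≤⇒<ᵇ≡false (≤-refl {a′}) | <⇒<ᵇ≡true a<a′ = refl
endpoints-between {a} {a′} {b} {b′} a<a′ b<b′ (inj₂ (a≢b , a≢b′ , a′≢b , a′≢b′))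
  rewrite <⇒<ᵇ≡true b<b′ | ≢⇒<ᵇ≡not a≢b | ≢⇒<ᵇ≡not a′≢b′ | ≢⇒<ᵇ≡not a′≢b
  with a <ᵇ b in e₁ | a <ᵇ b′ in e₂ | a′ <ᵇ b in e₃ | a′ <ᵇ b′ in e₄
... | true  | true  | true  | true  = refl
... | true  | true  | false | true  = refl
... | true  | true  | false | false = refl
... | false | true  | _     | true  = refl
... | false | true  | _     | false = refl
... | false | false | _     | _     = refl
... | true  | false | _     | _     = ⊥-elim (subst T (trans (sym (<⇒<ᵇ≡true (<-trans (<ᵇ⇒< a b (subst T (sym e₁) _)) b<b′))) e₂) _)
... | true  | true  | true  | false = ⊥-elim (subst T (trans (sym (<⇒<ᵇ≡true (<-trans (<ᵇ⇒< a′ b (subst T (sym e₃) _)) b<b′))) e₄) _)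

-- Squares modulo p and least absolute residues

-- The number `c` represents minus the common square. If the larger root exceeds the smaller by d,
-- then p ∣ d (y + z): either d = 0 because d < p, or y + z = p because 0 < y + z < 2 p.
same-square : ∀ {p c y z} → Prime p → y < p → z < p → 0 < y →
  p ∣ c + y * y → p ∣ c + z * z → y ≡ z ⊎ y + z ≡ p
same-square {p} {c} {y} {z} pr y<p z<p 0<y dy dz with ≤-total y z
... | inj₁ y≤z with d , refl ← m≤n⇒∃[o]m+o≡n y≤z
    with euclidsLemma d (y + (y + d)) pr (∣m+n∣m⇒∣n (subst (p ∣_) (ring c y d) dz) dy)
    where
    ring : ∀ c y d → c + (y + d) * (y + d) ≡ c + y * y + d * (y + (y + d))
    ring = solve-∀
... | inj₁ p∣d with refl ← ∣∧<⇒≡0 p∣d (≤-<-trans (m≤n+m d y) z<p) = inj₁ (sym (+-identityʳ y))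
... | inj₂ p∣s = inj₂ (∣∧<2*⇒≡ p∣s (<-≤-trans 0<y (m≤m+n y _)) (+-mono-< y<p z<p))
same-square {p} {c} {y} {z} pr y<p z<p 0<y dy dz | inj₂ z≤y with d , refl ← m≤n⇒∃[o]m+o≡n z≤y
    with euclidsLemma d (z + d + z) pr (∣m+n∣m⇒∣n (subst (p ∣_) (ring c z d) dy) dz)
    where
    ring : ∀ c y d → c + (y + d) * (y + d) ≡ c + y * y + d * (y + d + y)
    ring = solve-∀
... | inj₁ p∣d with refl ← ∣∧<⇒≡0 p∣d (≤-<-trans (m≤n+m d z) y<p) = inj₁ (+-identityʳ z)
... | inj₂ p∣s = inj₂ (∣∧<2*⇒≡ p∣s (<-≤-trans 0<y (m≤m+n (z + d) z)) (+-mono-< y<p z<p))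

square-neg : ∀ {p c r s} → r + s ≡ p → p ∣ c + r * r → p ∣ c + s * s
square-neg {c = c} {r} {s} refl d =
  ∣m+n∣n⇒∣m (subst (r + s ∣_) (ring c r s) (∣m∣n⇒∣m+n d (n∣m*n s))) (n∣m*n r)
  where
  ring : ∀ c r s → c + r * r + s * (r + s) ≡ c + s * s + r * (r + s)
  ring = solve-∀

square-% : ∀ {p} .{{_ : NonZero p}} c u → p ∣ c + u * u → p ∣ c + (u % p) * (u % p)
square-% {p} c u d =
  ∣m+n∣n⇒∣m (subst (p ∣_) (trans (cong (λ z → c + z * z) (m≡m%n+[m/n]*n u p)) (ring c (u % p) (u / p) p)) d)
            (n∣m*n (2 * (u % p) * (u / p) + u / p * (u / p) * p))
  where
  ring : ∀ c r q p → c + (r + q * p) * (r + q * p) ≡ c + r * r + (2 * r * q + q * q * p) * p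
  ring = solve-∀

-- Up to a multiple of p, `tilde` alters its argument at most by a sign, which squaring removes.
tilde-square : ∀ p c u .{{_ : NonZero p}} → p ∣ c + u * u → p ∣ c + tilde p u * tilde p u
tilde-square (suc q) c u d with suc q <ᵇ 2 * (u % suc q)
... | false = square-% c u d
... | true  = square-neg {s = suc q ∸ u % suc q} (m+[n∸m]≡n (<⇒≤ (m%n<n u (suc q)))) (square-% c u d)

-- The modulus 2 h + 1 is odd, so the test made by `tilde` amounts to h < r, and a residue above h
-- is reflected to at most h.
tilde≤ : ∀ h u → tilde (suc (h + h)) u ≤ h
tilde≤ h u with suc (h + h) <ᵇ 2 * (u % suc (h + h)) in eq
... | false = ≮⇒≥ λ h<r → subst T eq (<⇒<ᵇ (double< h<r))
  where
  double< : ∀ {r} → h < r → suc (h + h) < 2 * r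
  double< {r} h<r = subst (suc (h + h) <_) (cong (r +_) (sym (+-identityʳ r)))
    (≤-trans (s≤s (≤-reflexive (sym (+-suc h h)))) (+-mono-≤ h<r h<r))
... | true = m≤n+o⇒m∸n≤o _ r (≤-trans (s≤s (+-monoʳ-≤ h ≤-refl)) (+-monoˡ-≤ h h<r))
  where
  r = u % suc (h + h)
  h<r : h < r
  h<r = ≰⇒> λ r≤h → <⇒≱ (<ᵇ⇒< (suc (h + h)) (2 * r) (subst T (sym eq) _))
    (≤-trans (≤-trans (*-monoʳ-≤ 2 r≤h) (≤-reflexive (cong (h +_) (+-identityʳ h)))) (n≤1+n _))

-- The involution as a system of chords

module Chords {p h : ℕ} (pr : Prime p) (p≡ : p ≡ suc (h + h)) (σ : ℕ → ℕ)
  (σ-range : ∀ {x} → 0 < x → x ≤ h → 0 < σ x × σ x ≤ h)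
  (σ-square : ∀ {x} → 0 < x → x ≤ h → p ∣ x * x + σ x * σ x) where

  points lefts : List ℕ
  points = map suc (upTo h)
  lefts = filterᵇ (λ x → x <ᵇ σ x) points

  points⁺ : ∀ {x} → 0 < x → x ≤ h → x ∈ points
  points⁺ (s≤s z≤n) x≤h = ∈-map⁺ suc (∈-upTo⁺ x≤h)

  points⁻ : ∀ {x} → x ∈ points → 0 < x × x ≤ h
  points⁻ x∈ with i , i∈ , refl ← ∈-map⁻ suc x∈ = s≤s z≤n , ∈-upTo⁻ i∈

  points! : Unique points
  points! = Uniqueₚ.map⁺ suc-injective (Uniqueₚ.upTo⁺ h)

  lefts⁻ : ∀ {x} → x ∈ lefts → x ∈ points × x < σ x
  lefts⁻ x∈ with x∈′ , t ← ∈-filter⁻ (λ x → T? (x <ᵇ σ x)) {xs = points} x∈ = x∈′ , <ᵇ⇒< _ _ t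

  lefts⁺ : ∀ {x} → x ∈ points → x < σ x → x ∈ lefts
  lefts⁺ x∈ lt = ∈-filter⁺ (λ x → T? (x <ᵇ σ x)) x∈ (<⇒<ᵇ lt)

  lefts! : Unique lefts
  lefts! = Uniqueₚ.filter⁺ (λ x → T? (x <ᵇ σ x)) points!

  sum<p : ∀ {x y} → x ≤ h → y ≤ h → x + y < p
  sum<p x≤h y≤h = subst (_ <_) (sym p≡) (s≤s (+-mono-≤ x≤h y≤h))

  ≤h⇒<p : ∀ {x} → x ≤ h → x < p
  ≤h⇒<p {x} x≤h = ≤-<-trans (m≤m+n x x) (sum<p x≤h x≤h)

  -- Two numbers in 1, ..., h with equal squares modulo p coincide: the other possibility is that
  -- they add up to p, but their sum is at most 2 h < p. Values of `σ` are identified this way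
  -- below.
  σ-unique : ∀ {x y} → 0 < x → x ≤ h → 0 < y → y ≤ h → p ∣ x * x + y * y → σ x ≡ y
  σ-unique {x} 0<x x≤h 0<y y≤h d with 0<σx , σx≤h ← σ-range 0<x x≤h
    with same-square {c = x * x} pr (≤h⇒<p σx≤h) (≤h⇒<p y≤h) 0<σx (σ-square 0<x x≤h) d
  ... | inj₁ eq = eq
  ... | inj₂ eq = ⊥-elim (<⇒≢ (sum<p σx≤h y≤h) eq)

  σ-closed : ∀ {x} → x ∈ points → σ x ∈ points
  σ-closed x∈ with 0<x , x≤h ← points⁻ x∈ with 0<σx , σx≤h ← σ-range 0<x x≤h = points⁺ 0<σx σx≤h

  σ-involutive : ∀ {x} → x ∈ points → σ (σ x) ≡ x
  σ-involutive {x} x∈ with 0<x , x≤h ← points⁻ x∈ with 0<σx , σx≤h ← σ-range 0<x x≤h =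
    σ-unique 0<σx σx≤h 0<x x≤h (subst (p ∣_) (+-comm (x * x) _) (σ-square 0<x x≤h))

  -- A fixed point would give p ∣ (x + x) x, although both factors lie strictly between 0 and p.
  σ-free : ∀ {x} → x ∈ points → σ x ≢ x
  σ-free {x} x∈ eq with 0<x , x≤h ← points⁻ x∈
    with euclidsLemma (x + x) x pr (subst (p ∣_) (trans (cong (λ z → x * x + z * z) eq) (sym (*-distribʳ-+ x x x))) (σ-square 0<x x≤h))
  ... | inj₁ e = <⇒≢ (<-≤-trans 0<x (m≤m+n x x)) (sym (∣∧<⇒≡0 e (sum<p x≤h x≤h)))
  ... | inj₂ e = <⇒≢ 0<x (sym (∣∧<⇒≡0 e (≤h⇒<p x≤h)))

  -- The gap map permutes the left endpoints

  gap : ℕ → ℕ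
  gap a = σ a ∸ a

  -- (y − x)² + (y + x)² = 2 (x² + y²)
  gap-square : ∀ {a} → a ∈ lefts → p ∣ gap a * gap a + (a + σ a) * (a + σ a)
  gap-square {a} a∈ with a∈′ , a<σa ← lefts⁻ a∈ with 0<a , a≤h ← points⁻ a∈′ =
    subst (λ z → p ∣ gap a * gap a + (a + z) * (a + z)) σa≡
      (subst (p ∣_) (ring a (gap a))
        (∣n⇒∣m*n 2 (subst (λ z → p ∣ a * a + z * z) (sym σa≡) (σ-square 0<a a≤h))))
    where
    σa≡ : a + gap a ≡ σ a
    σa≡ = m+[n∸m]≡n (<⇒≤ a<σa)
    ring : ∀ a d → 2 * (a * a + (a + d) * (a + d)) ≡ d * d + (a + (a + d)) * (a + (a + d))
    ring = solve-∀

  gap-closed : ∀ {a} → a ∈ lefts → gap a ∈ lefts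
  gap-closed {a} a∈ with a∈′ , a<σa ← lefts⁻ a∈ with 0<a , a≤h ← points⁻ a∈′
    with 0<σa , σa≤h ← σ-range 0<a a≤h with <-≤-connex h (a + σ a)
  ... | inj₂ s≤h = lefts⁺ (points⁺ 0<d d≤h) (subst (gap a <_) (sym eq) (≤-<-trans (m∸n≤m (σ a) a) (m<n+m (σ a) 0<a)))
    where
    0<d = m<n⇒0<n∸m a<σa
    d≤h = ≤-trans (m∸n≤m (σ a) a) σa≤h
    eq : σ (gap a) ≡ a + σ a
    eq = σ-unique 0<d d≤h (<-≤-trans 0<a (m≤m+n a _)) s≤h (gap-square a∈)
  ... | inj₁ h<s = lefts⁺ (points⁺ 0<d d≤h) (subst (gap a <_) (sym eq) d<s′)
    where
    0<d = m<n⇒0<n∸m a<σa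
    d≤h = ≤-trans (m∸n≤m (σ a) a) σa≤h
    s s′ : ℕ
    s = a + σ a
    s′ = p ∸ s
    -- The sum telescopes to 2 σ a, which is at most 2 h; hence the gap is smaller than its partner
    -- p - s.
    d+s<p : gap a + s < p
    d+s<p = subst (_< p) (trans (cong (_+ σ a) (sym (m∸n+n≡m (<⇒≤ a<σa)))) (+-assoc (gap a) a (σ a))) (sum<p σa≤h σa≤h)
    d<s′ : gap a < s′
    d<s′ = m+n≤o⇒m≤o∸n (suc (gap a)) d+s<p
    s′≤h : s′ ≤ h
    s′≤h = m≤n+o⇒m∸n≤o _ s (subst (_≤ s + h) (sym p≡) (+-monoˡ-≤ h h<s))
    eq : σ (gap a) ≡ s′
    eq = σ-unique 0<d d≤h (≤-<-trans z≤n d<s′) s′≤h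
           (square-neg {c = gap a * gap a} {r = s} {s = s′} (m+[n∸m]≡n (<⇒≤ (sum<p a≤h σa≤h))) (gap-square a∈))

  -- If a and b have the same gap d, then a + σ a ≡ ± (b + σ b) modulo p; the
  -- negative sign would give 2 (a + b + d) = p, which is odd.
  gap-injective : InjectiveOn lefts gap
  gap-injective {a} {b} a∈ b∈ eq
    with a∈′ , a<σa ← lefts⁻ a∈ with 0<a , a≤h ← points⁻ a∈′ with 0<σa , σa≤h ← σ-range 0<a a≤h
    with b∈′ , b<σb ← lefts⁻ b∈ with 0<b , b≤h ← points⁻ b∈′ with 0<σb , σb≤h ← σ-range 0<b b≤h
    with same-square {c = gap a * gap a} pr (sum<p a≤h σa≤h) (sum<p b≤h σb≤h) (<-≤-trans 0<a (m≤m+n a _))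
           (gap-square a∈) (subst (λ z → p ∣ z * z + (b + σ b) * (b + σ b)) (sym eq) (gap-square b∈))
  ... | inj₁ same = *-cancelˡ-≡ a b 2 (+-cancelʳ-≡ d (2 * a) (2 * b) (trans (sym (sum≡ a a<σa)) (trans same (trans (sum≡ b b<σb) (cong (2 * b +_) (sym eq))))))
    where
    d = gap a
    ring : ∀ a d → a + (a + d) ≡ 2 * a + d
    ring = solve-∀
    sum≡ : ∀ a → a < σ a → a + σ a ≡ 2 * a + gap a
    sum≡ a a<σa = trans (cong (a +_) (sym (m+[n∸m]≡n (<⇒≤ a<σa)))) (ring a (gap a))
  ... | inj₂ opp = ⊥-elim (even≢odd (a + b + gap a) h (begin
    2 * (a + b + gap a)                         ≡⟨ ring a b (gap a) ⟩
    (a + (a + gap a)) + (b + (b + gap a))       ≡⟨ cong (λ z → (a + (a + gap a)) + (b + (b + z))) eq ⟩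
    (a + (a + gap a)) + (b + (b + gap b))       ≡⟨ cong₂ (λ u v → a + u + (b + v)) (m+[n∸m]≡n (<⇒≤ a<σa)) (m+[n∸m]≡n (<⇒≤ b<σb)) ⟩
    (a + σ a) + (b + σ b)                       ≡⟨ opp ⟩
    p                                           ≡⟨ p≡ ⟩
    suc (h + h)                                 ≡⟨ cong (λ z → suc (h + z)) (sym (+-identityʳ h)) ⟩
    suc (2 * h)                                 ∎))
    where
    open ≡-Reasoning
    ring : ∀ a b d → 2 * (a + b + d) ≡ (a + (a + d)) + (b + (b + d))
    ring = solve-∀

  -- Counting endpoints of chords

  -- No left endpoint is also a right one: a = σ b would give σ a = b, so that a < σ a contradicts b
  -- < σ b.
  compatible : ∀ {a b} → a ∈ lefts → b ∈ lefts → Compatible a (σ a) b (σ b)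
  compatible {a} {b} a∈ b∈ with a∈′ , a<σa ← lefts⁻ a∈ with b∈′ , b<σb ← lefts⁻ b∈ with a ≟ b
  ... | yes refl = inj₁ (refl , refl)
  ... | no a≢b = inj₂ (a≢b , apart a∈′ a<σa b∈′ b<σb , apart b∈′ b<σb a∈′ a<σa ∘ sym
                      , λ eq → a≢b (trans (sym (σ-involutive a∈′)) (trans (cong σ eq) (σ-involutive b∈′))))
    where
    apart : ∀ {a b} → a ∈ points → a < σ a → b ∈ points → b < σ b → a ≢ σ b
    apart a∈ a<σa b∈ b<σb refl = <-asym b<σb (subst (σ _ <_) (σ-involutive b∈) a<σa)

  sum-pairs : ∀ f → Sum.fold f points ≡ Sum.fold (λ x → f x + f (σ x)) lefts
  sum-pairs = Sum.fold-involution points! σ-closed σ-involutive σ-free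

  n ΣL ΣR #X #Y #Z : ℕ
  n = length lefts
  ΣL = Sum.fold (λ a → a) lefts
  ΣR = Sum.fold σ lefts
  #X = double (crossing σ) lefts lefts
  #Y = double (disjoint σ) lefts lefts
  #Z = double (nested σ) lefts lefts

  size : n * 2 ≡ h
  size = begin
    n * 2                       ≡⟨ sym (sum-const 2 lefts) ⟩
    Sum.fold (λ _ → 2) lefts    ≡⟨ sym (sum-pairs (λ _ → 1)) ⟩
    Sum.fold (λ _ → 1) points   ≡⟨ sum-const 1 points ⟩
    length points * 1           ≡⟨ *-identityʳ _ ⟩
    length points               ≡⟨ length-map suc (upTo h) ⟩
    length (upTo h)             ≡⟨ length-upTo h ⟩
    h                           ∎
    where open ≡-Reasoning

  total : 2 * (ΣL + ΣR) ≡ h * suc h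
  total = trans (cong (2 *_) (trans (sym (Sum.fold-∙ (λ a → a) σ lefts)) (sym (sum-pairs (λ a → a))))) (sum-1⋯ h)

  ΣR≡2ΣL : ΣR ≡ ΣL + ΣL
  ΣR≡2ΣL = begin
    Sum.fold σ lefts                      ≡⟨ Sum.fold-cong lefts (λ a∈ → sym (m+[n∸m]≡n (<⇒≤ (proj₂ (lefts⁻ a∈))))) ⟩
    Sum.fold (λ a → a + gap a) lefts      ≡⟨ Sum.fold-∙ (λ a → a) gap lefts ⟩
    ΣL + Sum.fold gap lefts               ≡⟨ cong (λ l → ΣL + sum l) (map-∘ {g = λ a → a} {f = gap} lefts) ⟩
    ΣL + Sum.fold (λ a → a) (map gap lefts)
      ≡⟨ cong (ΣL +_) (Sum.fold-↭ (λ a → a) (map-injection-↭ lefts! gap-closed gap-injective)) ⟩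
    ΣL + ΣL                               ∎
    where open ≡-Reasoning

  -- There are a - 1 points below a left endpoint a. `sum-pairs` distributes them over the chords,
  -- `endpoints-below` sorts those by position, and `n` restores the missing 1 for each a.
  count-below : #Y + #Y + #X + #Z + n ≡ ΣL
  count-below = begin
    #Y + #Y + #X + #Z + n
      -- In `endpoints-below` the chord of b comes first, so all the double sums are transposed.
      ≡⟨ cong (_+ n) (cong₂ _+_ (cong₂ _+_ (cong₂ _+_ (sw (disjoint σ)) (sw (disjoint σ))) (sw (crossing σ))) (sw (nested σ))) ⟩
    D y + D y + D x + D z + n
      ≡⟨ cong (_+ n) (sym (trans (double-+ _ z lefts lefts) (cong (_+ D z) (trans (double-+ _ x lefts lefts) (cong (_+ D x) (double-+ y y lefts lefts)))))) ⟩
    D (λ a b → y a b + y a b + x a b + z a b) + n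
      ≡⟨ cong₂ _+_ (sym (Sum.fold-cong lefts λ a∈ → Sum.fold-cong lefts λ b∈ →
            endpoints-below (proj₂ (lefts⁻ a∈)) (proj₂ (lefts⁻ b∈)) (compatible a∈ b∈)))
           (sym (trans (sum-const 1 lefts) (*-identityʳ n))) ⟩
    D (λ a b → 𝟙 (b <ᵇ a) + 𝟙 (σ b <ᵇ a)) + Sum.fold (λ _ → 1) lefts
      ≡⟨ sym (Sum.fold-∙ (λ a → Sum.fold (λ b → 𝟙 (b <ᵇ a) + 𝟙 (σ b <ᵇ a)) lefts) (λ _ → 1) lefts) ⟩
    Sum.fold (λ a → Sum.fold (λ b → 𝟙 (b <ᵇ a) + 𝟙 (σ b <ᵇ a)) lefts + 1) lefts
      ≡⟨ Sum.fold-cong lefts pointwise ⟩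
    ΣL ∎
    where
    open ≡-Reasoning
    D : (ℕ → ℕ → ℕ) → ℕ
    D f = double f lefts lefts
    x y z : ℕ → ℕ → ℕ
    x a b = crossing σ b a
    y a b = disjoint σ b a
    z a b = nested σ b a
    sw : ∀ f → D f ≡ D (λ a b → f b a)
    sw f = double-swap f lefts lefts
    pointwise : ∀ {a} → a ∈ lefts → Sum.fold (λ b → 𝟙 (b <ᵇ a) + 𝟙 (σ b <ᵇ a)) lefts + 1 ≡ a
    pointwise a∈ with points⁻ (proj₁ (lefts⁻ a∈))
    pointwise {suc a} a∈ | _ , a≤h =
      trans (+-comm _ 1) (cong suc (trans (sym (sum-pairs (λ b → 𝟙 (b <ᵇ suc a)))) (sum-below (<⇒≤ a≤h))))

  -- Strictly between a and σ a lie σ a - a - 1 points, sorted by `endpoints-between`; the summand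
  -- ΣL + n supplies the a + 1 for every left endpoint.
  count-between : #X + #X + #Z + #Z + (ΣL + n) ≡ ΣR
  count-between = begin
    #X + #X + #Z + #Z + (ΣL + n)
      -- A chord crossing that of a may start on either side of a, so one copy of `#X` is
      -- transposed.
      ≡⟨ cong (λ u → #X + u + #Z + #Z + (ΣL + n)) (double-swap (crossing σ) lefts lefts) ⟩
    D x + D x′ + D z + D z + (ΣL + n)
      ≡⟨ cong₂ _+_ (sym (trans (double-+ _ z lefts lefts) (cong (_+ D z) (trans (double-+ _ z lefts lefts) (cong (_+ D z) (double-+ x x′ lefts lefts))))))
           (trans (+-comm ΣL n) (trans (cong (_+ ΣL) (sym (trans (sum-const 1 lefts) (*-identityʳ n)))) (sym (Sum.fold-∙ (λ _ → 1) (λ a → a) lefts)))) ⟩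
    D (λ a b → x a b + x′ a b + z a b + z a b) + Sum.fold suc lefts
      ≡⟨ cong (_+ Sum.fold suc lefts) (sym (Sum.fold-cong lefts λ a∈ → Sum.fold-cong lefts λ b∈ →
            endpoints-between (proj₂ (lefts⁻ a∈)) (proj₂ (lefts⁻ b∈)) (compatible a∈ b∈))) ⟩
    D (λ a b → between a b + between a (σ b)) + Sum.fold suc lefts
      ≡⟨ sym (Sum.fold-∙ (λ a → Sum.fold (λ b → between a b + between a (σ b)) lefts) suc lefts) ⟩
    Sum.fold (λ a → Sum.fold (λ b → between a b + between a (σ b)) lefts + suc a) lefts
      ≡⟨ Sum.fold-cong lefts pointwise ⟩
    ΣR ∎
    where
    open ≡-Reasoning
    D : (ℕ → ℕ → ℕ) → ℕ
    D f = double f lefts lefts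
    x x′ z between : ℕ → ℕ → ℕ
    x = crossing σ
    x′ a b = crossing σ b a
    z = nested σ
    between a b = 𝟙 ((a <ᵇ b) ∧ (b <ᵇ σ a))
    pointwise : ∀ {a} → a ∈ lefts → Sum.fold (λ b → between a b + between a (σ b)) lefts + suc a ≡ σ a
    pointwise {a} a∈ with a∈′ , a<σa ← lefts⁻ a∈ with 0<a , a≤h ← points⁻ a∈′ =
      trans (cong (_+ suc a) (sym (sum-pairs (between a)))) (sum-between a<σa (proj₂ (σ-range 0<a a≤h)))

  ΣL≡ : #X + #X + #Z + #Z + n ≡ ΣL
  ΣL≡ = +-cancelˡ-≡ ΣL _ _ (trans (ring ΣL (#X + #X + #Z + #Z) n) (trans count-between ΣR≡2ΣL))
    where
    ring : ∀ l s n → l + (s + n) ≡ s + (l + n)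
    ring = solve-∀

  -- The two counts give two expressions for `ΣL`; comparing them leaves this relation.
  #X+#Z≡2#Y : #X + #Z ≡ 2 * #Y
  #X+#Z≡2#Y = +-cancelʳ-≡ (#X + #Z + n) _ _ (begin
    #X + #Z + (#X + #Z + n)         ≡⟨ ring₁ #X #Z n ⟩
    #X + #X + #Z + #Z + n           ≡⟨ ΣL≡ ⟩
    ΣL                              ≡⟨ sym count-below ⟩
    #Y + #Y + #X + #Z + n           ≡⟨ ring₂ #X #Y #Z n ⟩
    2 * #Y + (#X + #Z + n)          ∎)
    where
    open ≡-Reasoning
    ring₁ : ∀ x z n → x + z + (x + z + n) ≡ x + x + z + z + n
    ring₁ = solve-∀
    ring₂ : ∀ x y z n → y + y + x + z + n ≡ 2 * y + (x + z + n)
    ring₂ = solve-∀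

  -- Now ΣL = 4 |Y| + n, while 3 ΣL = ΣL + ΣR = n (2 n + 1) because h = 2 n. The chain proves this
  -- multiplied by 2, regrouped so that 2 n and then 4 cancel.
  6#Y+n≡n² : 6 * #Y + n ≡ n * n
  6#Y+n≡n² = *-cancelˡ-≡ _ _ 4 (+-cancelʳ-≡ (2 * n) _ _ (begin
    4 * (6 * #Y + n) + 2 * n              ≡⟨ ring₁ #Y n ⟩
    2 * (3 * (2 * (2 * #Y) + n))          ≡⟨ cong (λ u → 2 * (3 * (2 * u + n))) (sym #X+#Z≡2#Y) ⟩
    2 * (3 * (2 * (#X + #Z) + n))         ≡⟨ cong (λ u → 2 * (3 * u)) (trans (ring₂ #X #Z n) ΣL≡) ⟩
    2 * (3 * ΣL)                          ≡⟨ ring₃ ΣL ⟩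
    2 * (ΣL + (ΣL + ΣL))                  ≡⟨ cong (λ u → 2 * (ΣL + u)) (sym ΣR≡2ΣL) ⟩
    2 * (ΣL + ΣR)                         ≡⟨ total ⟩
    h * suc h                             ≡⟨ cong (λ u → u * suc u) (sym size) ⟩
    n * 2 * suc (n * 2)                   ≡⟨ ring₄ n ⟩
    4 * (n * n) + 2 * n                   ∎))
    where
    open ≡-Reasoning
    ring₁ : ∀ y n → 4 * (6 * y + n) + 2 * n ≡ 2 * (3 * (2 * (2 * y) + n))
    ring₁ = solve-∀
    ring₂ : ∀ x z n → 2 * (x + z) + n ≡ x + x + z + z + n
    ring₂ = solve-∀
    ring₃ : ∀ l → 2 * (3 * l) ≡ 2 * (l + (l + l))
    ring₃ = solve-∀
    ring₄ : ∀ n → n * 2 * suc (n * 2) ≡ 4 * (n * n) + 2 * n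
    ring₄ = solve-∀

-- The map `bar` and the final evaluation

-- Here 6 y = n (n - 1) and (p - 1)(p - 5) = 16 n (n - 1). The case n = 0 is split off because p ∸ 5
-- truncates there.
rescale : ∀ {p} y n → p ≡ 1 + 4 * n → 6 * y + n ≡ n * n → 96 * y ≡ (p ∸ 1) * (p ∸ 5)
rescale y zero refl eq = trans (ring y) (cong (16 *_) (trans (sym (+-identityʳ (6 * y))) eq))
  where
  ring : ∀ y → 96 * y ≡ 16 * (6 * y)
  ring = solve-∀
rescale y (suc n) refl eq = begin
  96 * y                         ≡⟨ ring₁ y ⟩
  16 * (6 * y)                   ≡⟨ cong (16 *_) (+-cancelʳ-≡ (suc n) (6 * y) (n * suc n) (trans eq (+-comm (suc n) _))) ⟩
  16 * (n * suc n)               ≡⟨ ring₂ n ⟩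
  4 * suc n * (4 * n)            ≡⟨ cong (4 * suc n *_) (sym (trans (cong (_∸ 4) (*-suc 4 n)) (m+n∸m≡n 4 (4 * n)))) ⟩
  4 * suc n * (4 * suc n ∸ 4)    ∎
  where
  open ≡-Reasoning
  ring₁ : ∀ y → 96 * y ≡ 16 * (6 * y)
  ring₁ = solve-∀
  ring₂ : ∀ n → 16 * (n * suc n) ≡ 4 * suc n * (4 * n)
  ring₂ = solve-∀

module Bar (p : ℕ) (pr : Prime p) (p%4≡1 : p % 4 ≡ 1) where

  k h t : ℕ
  k = p / 4
  h = half p
  t = tval p

  p≡1+4k : p ≡ suc (k + k + (k + k))
  p≡1+4k = trans (m≡m%n+[m/n]*n p 4) (trans (cong (_+ k * 4) p%4≡1) (ring k))
    where
    ring : ∀ k → 1 + k * 4 ≡ suc (k + k + (k + k))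
    ring = solve-∀

  h≡2k : h ≡ k + k
  h≡2k = begin
    (p ∸ 1) / 2                 ≡⟨ cong (λ z → (z ∸ 1) / 2) p≡1+4k ⟩
    (k + k + (k + k)) / 2       ≡⟨ cong (_/ 2) (ring k) ⟩
    (k + k) * 2 / 2             ≡⟨ m*n/n≡m (k + k) 2 ⟩
    k + k                       ∎
    where
    open ≡-Reasoning
    ring : ∀ k → k + k + (k + k) ≡ (k + k) * 2
    ring = solve-∀

  p≡1+2h : p ≡ suc (h + h)
  p≡1+2h = trans p≡1+4k (cong (λ z → suc (z + z)) (sym h≡2k))

  -- Since h = 2 k is even, `wilson-split` can be taken at its midpoint, where both factorials equal
  -- t.
  p∣t²+1 : p ∣ t * t + 1
  p∣t²+1 = subst (λ z → p ∣ z ! * z ! + 1) (sym h≡2k) (wilson-split pr k (k + k) (sym p≡1+4k))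

  -- Multiplying p ∣ t² + 1 by x² gives p ∣ x² + (t x)², and `tilde` preserves the square of t x.
  bar-square : ∀ x → p ∣ x * x + bar p x * bar p x
  bar-square x = tilde-square p (x * x) (t * x) {{prime⇒nonZero pr}}
    (subst (p ∣_) (ring t x) (∣m⇒∣m*n (x * x) p∣t²+1))
    where
    ring : ∀ t x → (t * t + 1) * (x * x) ≡ x * x + t * x * (t * x)
    ring = solve-∀

  bar≤h : ∀ x → bar p x ≤ h
  bar≤h x = subst (λ q → tilde q (t * x) ≤ h) (sym p≡1+2h) (tilde≤ h (t * x))

  bar-positive : ∀ {x} → 0 < x → x ≤ h → 0 < bar p x
  bar-positive {x} 0<x x≤h with bar p x | bar-square x
  ... | suc _ | _ = s≤s z≤n
  ... | zero  | d = ⊥-elim (<⇒≢ 0<x (sym (∣∧<⇒≡0 p∣x (subst (x <_) (sym p≡1+2h) (s≤s (≤-trans x≤h (m≤m+n h h)))))))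
    where
    p∣x : p ∣ x
    p∣x = [ id , id ]′ (euclidsLemma x x pr (subst (p ∣_) (+-identityʳ (x * x)) d))

  open Chords pr p≡1+2h (bar p) (λ {x} 0<x x≤h → bar-positive 0<x x≤h , bar≤h x) (λ {x} _ _ → bar-square x) public

  n≡k : n ≡ k
  n≡k = *-cancelʳ-≡ n k 2 (trans size (trans h≡2k (ring k)))
    where
    ring : ∀ k → k + k ≡ k * 2
    ring = solve-∀

  p≡1+4n : p ≡ 1 + 4 * n
  p≡1+4n = trans p≡1+4k (trans (ring k) (cong (λ z → 1 + 4 * z) (sym n≡k)))
    where
    ring : ∀ k → suc (k + k + (k + k)) ≡ 1 + 4 * k
    ring = solve-∀

theorem3p1 : (p : ℕ) → Prime p → p % 4 ≡ 1 →
    (96 * length (Y p) ≡ (p ∸ 1) * (p ∸ 5))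
    × (96 * (length (X p) + length (Z p)) ≡ 2 * ((p ∸ 1) * (p ∸ 5)))
theorem3p1 p pr p%4≡1 =
  rescale (length (Y p)) n p≡1+4n (trans (cong (λ y → 6 * y + n) |Y|) 6#Y+n≡n²) , scaled
  where
  open Bar p pr p%4≡1
  -- `V p` and `lefts` unfold to the same list, and the three filters to the three chord indicators
  -- at σ = `bar p`.
  |X| : length (X p) ≡ #X
  |X| = length-filterᵇ-pairs _ (V p) (V p)
  |Y| : length (Y p) ≡ #Y
  |Y| = length-filterᵇ-pairs _ (V p) (V p)
  |Z| : length (Z p) ≡ #Z
  |Z| = length-filterᵇ-pairs _ (V p) (V p)
  swap : ∀ y → 96 * (2 * y) ≡ 2 * (96 * y)
  swap = solve-∀
  scaled : 96 * (length (X p) + length (Z p)) ≡ 2 * ((p ∸ 1) * (p ∸ 5))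
  scaled = trans (cong (96 *_) (trans (cong₂ _+_ |X| |Z|) #X+#Z≡2#Y))
             (trans (swap #Y) (cong (2 *_) (rescale #Y n p≡1+4n 6#Y+n≡n²)))
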